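{- Let $\mathcal{M}$ be a directed pseudoforest. Then $\mathcal{M}$ is ultrahomogeneous if and only if $\mathcal{M}=\mathcal{A}^*$ where $\mathcal{A}$ is a partial monounary algebra isomorphic to one of: (i) $\alpha\cdot\mathcal{Z}_2$ for some cardinal $\alpha$; (ii) $\alpha\cdot\mathcal{Z}_3$ for some cardinal $\alpha$; (iii) $\mathcal{Z}_4$; (iv) $(A;\theta)$ with $\mathrm{dom}(\theta)=\emptyset$.
   Context: A partial monounary algebra is a pair $\mathcal{A}=(A;\theta)$ where $A$ is a nonempty set (of arbitrary cardinality) and $\theta$ is a partial unary operation on $A$ with domain $\mathrm{dom}(\theta)\subseteq A$. Its relational form is the digraph $\mathcal{A}^*=(A;R_\theta)$ with $(x,y)\in R_\theta$ iff $x\in\mathrm{dom}(\theta)$ and $\theta(x)=y$. An isomorphism of partial monounary algebras is a bijection preserving, in both directions, the domain of the operation and commuting with it. A directed pseudoforest is a loopless digraph (with nonempty vertex set, of arbitrary cardinality; edges $(x,y)$ and $(y,x)$ may both be present) in which each vertex has at most one outgoing edge. A digraph is ultrahomogeneous if every isomorphism between finite induced subdigraphs extends to an automorphism. $\mathcal{Z}_n$ is the $n$-cycle $(\{0,\dots,n-1\};\, i\mapsto i+1 \bmod n)$, and $\alpha\cdot\mathcal{C}$ is the disjoint union of $\alpha$ copies of $\mathcal{C}$. -}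

module Defs where

open import Data.Fin.Base using (Fin; toℕ)
open import Data.Nat.Base using (ℕ; NonZero)
open import Data.Nat.DivMod using (_mod_)
open import Data.Product.Base using (Σ; ∃; _×_; _,_)
open import Function.Bundles using (_⇔_; _↔_; _↣_; Inverse; Injection)
open import Level using (Level; _⊔_; 0ℓ) renaming (suc to lsuc)
open import Relation.Binary.Core using (Rel)
open import Relation.Binary.Definitions using (Irreflexive)
open import Relation.Binary.PropositionalEquality.Core using (_≡_; refl; cong)
open import Relation.Unary using (Pred; _∈_; U)

private
  variable
    a b d e r s : Level

record Digraph (a r : Level) : Set (lsuc (a ⊔ r)) where
  constructor mkDigraph
  field
    Vertex : Set a
    Edge   : Rel Vertex r

open Digraph

-- Equality of digraphs: literally the same vertex type, and edge relations
-- with the same extension.  (_≡_ would be too fine: the two relations may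
-- live in different universes and have differently shaped proofs.)

infix 4 _≐_

data _≐_ {a r s} : Digraph a r → Digraph a s → Set (lsuc (a ⊔ r ⊔ s)) where
  same : {V : Set a} {R : Rel V r} {S : Rel V s} →
         (∀ x y → R x y ⇔ S x y) → mkDigraph V R ≐ mkDigraph V S

record DigraphIsomorphism (G : Digraph a r) (H : Digraph b s) : Set (a ⊔ b ⊔ r ⊔ s) where
  field
    bijection : Vertex G ↔ Vertex H

  open Inverse bijection public using (to; from)

  field
    edges : ∀ x y → Edge G x y ⇔ Edge H (to x) (to y)

DigraphAutomorphism : Digraph a r → Set (a ⊔ r)
DigraphAutomorphism G = DigraphIsomorphism G G

-- A subset of the vertices is given as the image of an injection u, and the
-- subdigraph induced on it is the pullback of the edge relation along u.
-- The finite subsets are those with domain Fin n, including n = 0.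

induced : (G : Digraph a r) {S : Set s} → S ↣ Vertex G → Digraph s r
induced G {S} u = mkDigraph S λ i j → Edge G (Injection.to u i) (Injection.to u j)

Ultrahomogeneous : Digraph a r → Set (a ⊔ r)
Ultrahomogeneous G =
  ∀ {m n : ℕ} (u : Fin m ↣ Vertex G) (v : Fin n ↣ Vertex G)
  (f : DigraphIsomorphism (induced G u) (induced G v)) →
  ∃ λ (φ : DigraphAutomorphism G) →
    ∀ i → DigraphIsomorphism.to φ (Injection.to u i)
        ≡ Injection.to v (DigraphIsomorphism.to f i)

-- The field point only records that the vertex set is nonempty; nothing is
-- required to preserve it.  The same holds for partial monounary algebras.

record DirectedPseudoforest (a r : Level) : Set (lsuc (a ⊔ r)) where
  field
    digraph      : Digraph a r
    point        : Vertex digraph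
    loopless     : Irreflexive _≡_ (Edge digraph)
    outdegree≤1  : ∀ {x y z} → Edge digraph x y → Edge digraph x z → y ≡ z

-- The operation takes a proof that its argument is in the domain;
-- θ-irrelevant says that its value does not depend on which proof.

record PartialMonounaryAlgebra (a d : Level) : Set (lsuc (a ⊔ d)) where
  field
    Carrier      : Set a
    point        : Carrier
    dom          : Pred Carrier d
    θ            : ∀ x → x ∈ dom → Carrier
    θ-irrelevant : ∀ {x} (p q : x ∈ dom) → θ x p ≡ θ x q

open PartialMonounaryAlgebra

infix 8 _*

_* : PartialMonounaryAlgebra a d → Digraph a (a ⊔ d)
A * = mkDigraph (Carrier A) λ x y → Σ (x ∈ dom A) λ p → θ A x p ≡ y

infix 4 _≅_

record _≅_ (A : PartialMonounaryAlgebra a d) (B : PartialMonounaryAlgebra b e)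
           : Set (a ⊔ b ⊔ d ⊔ e) where
  field
    bijection : Carrier A ↔ Carrier B

  open Inverse bijection public using (to; from)

  field
    domain   : ∀ x → x ∈ dom A ⇔ to x ∈ dom B
    commutes : ∀ x (p : x ∈ dom A) (q : to x ∈ dom B) → to (θ A x p) ≡ θ B (to x) q

𝒵 : (n : ℕ) .{{_ : NonZero n}} → PartialMonounaryAlgebra 0ℓ 0ℓ
𝒵 n = record
  { Carrier      = Fin n
  ; point        = 0 mod n
  ; dom          = U
  ; θ            = λ i _ → ℕ.suc (toℕ i) mod n
  ; θ-irrelevant = λ _ _ → refl
  }

-- The disjoint union of α copies of C, for a cardinal α represented by a
-- type I.  As algebras are nonempty, α must be nonzero, whence i₀.

copies : (I : Set b) → I → PartialMonounaryAlgebra a d → PartialMonounaryAlgebra (a ⊔ b) d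
copies I i₀ C = record
  { Carrier      = I × Carrier C
  ; point        = i₀ , point C
  ; dom          = λ (_ , x) → x ∈ dom C
  ; θ            = λ (i , x) p → i , θ C x p
  ; θ-irrelevant = λ {(i , _)} p q → cong (i ,_) (θ-irrelevant C p q)
  }

{-# OPTIONS --safe #-}

-- Since there are no loops, single vertices are exchanged by automorphisms, so in an
-- ultrahomogeneous pseudoforest either no vertex has an outgoing edge or every vertex x
-- has one, to θ x.  In the second case, for each k, θᵏ x ≡ x holds for all x or none.  If k = 2
-- or k = 3 works, the graph consists of cycles of that length.  Otherwise x and θ² x are
-- distinct and nonadjacent; an automorphism exchanging them yields θ⁴ x ≡ x, and one
-- fixing x while moving θ² x to any vertex y nonadjacent to x yields y ≡ θ² x, so there
-- is a single 4-cycle.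
--
-- Conversely it suffices to extend partial isomorphisms by one point: given finitely many
-- fixed vertices and x, y of the same type over them, find an automorphism fixing them and
-- sending x to y.  If a fixed vertex lies on the cycle of x or of y then x ≡ y; otherwise
-- exchange the two cycles, rotated appropriately.

module Submission where

open import Axiom.ExcludedMiddle using (ExcludedMiddle)
open import Axiom.Extensionality.Propositional using (Extensionality; lower-extensionality)
open import Data.Bool.Base using (Bool; T)
open import Data.Empty using (⊥-elim)
open import Data.Fin.Base using (Fin; toℕ)
open import Data.Fin.Patterns using (0F; 1F)
open import Data.Fin.Properties using (_≟_; all?; any?; toℕ-fromℕ<; toℕ-injective; toℕ<n)
open import Data.Nat.Base using (ℕ; zero; suc; _+_; _*_; _∸_; _<_; s<s; nonZero; NonZero)
open import Data.Nat.DivMod using (_mod_; _%_; _/_; m%n<n; m≡m%n+[m/n]*n)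
open import Data.Nat.GeneralisedArithmetic using (fold; fold-+)
open import Data.Nat.Properties
  using (+-comm; +-monoʳ-<; <-cmp; <⇒≤; m∸n+n≡m; m<n⇒0<n∸m; m≤m+n; m≤m*n; ≤-trans)
open import Data.Product.Base using (Σ; ∃; _×_; _,_; proj₁; proj₂)
open import Data.Sum.Base using (_⊎_; inj₁; inj₂)
open import Function.Base using (_∘_; case_of_)
open import Function.Bundles
  using (_⇔_; _↔_; _↣_; Inverse; Injection; Equivalence; mk⇔; mk↣; mk↔ₛ′)
open import Function.Construct.Composition using (_⇔-∘_; _↔-∘_; _↣-∘_)
open import Function.Construct.Identity using (⇔-id; ↔-id)
open import Function.Construct.Symmetry using (⇔-sym; ↔-sym)
open import Function.Properties.Inverse using (↔⇒↣)
open import Level using (Level; Lift; lift; lower; _⊔_; 0ℓ)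
open import Relation.Binary.Core using (Rel)
open import Relation.Binary.Definitions using (DecidableEquality; tri<; tri≈; tri>)
open import Relation.Binary.PropositionalEquality
  using (_≡_; _≢_; refl; sym; trans; cong; cong₂; subst; subst₂; module ≡-Reasoning)
open import Relation.Binary.PropositionalEquality.WithK using (≡-irrelevant)
open import Relation.Binary.Structures using (IsEquivalence)
open import Relation.Nullary.Decidable
  using (Dec; yes; no; map′; isYes; isYes≗does; does-⇔; recompute; toWitness; fromWitness;
         from-yes; _→-dec_; _⊎-dec_)
open import Relation.Nullary.Negation using (¬_; contradiction)
open import Relation.Unary using (Empty)
open import Defs

open Digraph
open DigraphIsomorphism using (to; from; bijection; edges)
open PartialMonounaryAlgebra hiding (point)

private
  variable
    a b c d e r r₁ r₂ : Level

-- Isomorphisms of digraphs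

iso-id : {G : Digraph a r} → DigraphAutomorphism G
iso-id = record { bijection = ↔-id _ ; edges = λ _ _ → ⇔-id _ }

iso-trans : {G : Digraph a r} {H : Digraph b r₁} {K : Digraph c r₂} →
            DigraphIsomorphism G H → DigraphIsomorphism H K → DigraphIsomorphism G K
iso-trans f g = record
  { bijection = bijection g ↔-∘ bijection f
  ; edges     = λ x y → edges g (to f x) (to f y) ⇔-∘ edges f x y
  }

module _ {G : Digraph a r} {H : Digraph b r₁} (f : DigraphIsomorphism G H) where

  to-from : ∀ y → to f (from f y) ≡ y
  to-from = Inverse.strictlyInverseˡ (bijection f)

  from-to : ∀ x → from f (to f x) ≡ x
  from-to = Inverse.strictlyInverseʳ (bijection f)

  to-injective : ∀ {x y} → to f x ≡ to f y → x ≡ y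
  to-injective = Injection.injective (↔⇒↣ (bijection f))

  edge-to : ∀ {x y} → Edge G x y → Edge H (to f x) (to f y)
  edge-to {x} {y} = Equivalence.to (edges f x y)

  edge-from : ∀ {x y} → Edge H (to f x) (to f y) → Edge G x y
  edge-from {x} {y} = Equivalence.from (edges f x y)

  to-≡⇔ : ∀ {x y} → to f x ≡ to f y ⇔ x ≡ y
  to-≡⇔ = mk⇔ to-injective (cong (to f))

  iso-sym : DigraphIsomorphism H G
  iso-sym = record
    { bijection = ↔-sym (bijection f)
    ; edges     = λ x y → mk⇔
        (edge-from ∘ subst₂ (Edge H) (sym (to-from x)) (sym (to-from y)))
        (subst₂ (Edge H) (to-from x) (to-from y) ∘ edge-to)
    }

≐⇒iso : {G : Digraph a r} {H : Digraph a r₁} → G ≐ H → DigraphIsomorphism G H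
≐⇒iso (same h) = record { bijection = ↔-id _ ; edges = h }

≅⇒iso : {A : PartialMonounaryAlgebra a d} {B : PartialMonounaryAlgebra b e} →
        A ≅ B → DigraphIsomorphism (A *) (B *)
≅⇒iso {A = A} {B} h = record
  { bijection = h.bijection
  ; edges     = λ x y → mk⇔
      (λ (p , θx≡y) → Equivalence.to (h.domain x) p ,
                      trans (sym (h.commutes x p _)) (cong h.to θx≡y))
      (λ (q , e) → let p = Equivalence.from (h.domain x) q in
                   p , Injection.injective (↔⇒↣ h.bijection) (trans (h.commutes x p q) e))
  }
  where module h = _≅_ h

-- Ultrahomogeneity by one-point extensions

-- Equality of the atomic types of `x` and `y` over the single parameter `v`.
record SameType (G : Digraph a r) (v x y : Vertex G) : Set (a ⊔ r) where
  field
    equal    : v ≡ x ⇔ v ≡ y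
    edge-in  : Edge G v x ⇔ Edge G v y
    edge-out : Edge G x v ⇔ Edge G y v

SameType-sym : {G : Digraph a r} {v x y : Vertex G} → SameType G v x y → SameType G v y x
SameType-sym t = record
  { equal = ⇔-sym equal ; edge-in = ⇔-sym edge-in ; edge-out = ⇔-sym edge-out }
  where open SameType t

OnePointHomogeneous : Digraph a r → Set (a ⊔ r)
OnePointHomogeneous G =
  ∀ {n} (v : Fin n → Vertex G) x y → (∀ i → SameType G (v i) x y) →
  ∃ λ (φ : DigraphAutomorphism G) → to φ x ≡ y × (∀ i → to φ (v i) ≡ v i)

module _ {G : Digraph a r} where

  -- Induction on the number of points: `φ` matches all but the first, and one-point homogeneity
  -- supplies `ψ`, which fixes those images and corrects the image of the first.
  extend : OnePointHomogeneous G → ∀ {n} (u v : Fin n → Vertex G) →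
           (∀ i j → u i ≡ u j ⇔ v i ≡ v j) →
           (∀ i j → Edge G (u i) (u j) ⇔ Edge G (v i) (v j)) →
           ∃ λ (φ : DigraphAutomorphism G) → ∀ i → to φ (u i) ≡ v i
  extend one {zero}  u v _ _ = iso-id , λ ()
  extend one {suc n} u v eq ed = iso-trans φ ψ , agree
    where
    tail = extend one (u ∘ Fin.suc) (v ∘ Fin.suc)
             (λ i j → eq (Fin.suc i) (Fin.suc j)) (λ i j → ed (Fin.suc i) (Fin.suc j))
    φ = proj₁ tail
    φu≡v = proj₂ tail

    -- `φ` preserves equality and edges, so `to φ (u 0F)` relates to the points
    -- `to φ (u (Fin.suc i))` as `u 0F` does to the points `u (Fin.suc i)`.
    sameType : ∀ i → SameType G (v (Fin.suc i)) (to φ (u 0F)) (v 0F)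
    sameType i = subst (λ w → SameType G w (to φ (u 0F)) (v 0F)) (φu≡v i) (record
      { equal    = subst (λ w → _ ⇔ w ≡ v 0F) (sym (φu≡v i)) (eq (Fin.suc i) 0F) ⇔-∘ to-≡⇔ φ
      ; edge-in  = subst (λ w → _ ⇔ Edge G w (v 0F)) (sym (φu≡v i)) (ed (Fin.suc i) 0F)
                   ⇔-∘ ⇔-sym (edges φ _ _)
      ; edge-out = subst (λ w → _ ⇔ Edge G (v 0F) w) (sym (φu≡v i)) (ed 0F (Fin.suc i))
                   ⇔-∘ ⇔-sym (edges φ _ _)
      })

    step = one (v ∘ Fin.suc) (to φ (u 0F)) (v 0F) sameType
    ψ = proj₁ step

    agree : ∀ i → to ψ (to φ (u i)) ≡ v i
    agree 0F          = proj₁ (proj₂ step)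
    agree (Fin.suc i) = trans (cong (to ψ) (φu≡v i)) (proj₂ (proj₂ step) i)

  onePoint⇒ultrahomogeneous : OnePointHomogeneous G → Ultrahomogeneous G
  onePoint⇒ultrahomogeneous one u v f =
    extend one (Injection.to u) (Injection.to v ∘ to f)
      (λ i j → mk⇔ (cong (Injection.to v ∘ to f) ∘ Injection.injective u)
                   (cong (Injection.to u) ∘ to-injective f ∘ Injection.injective v))
      (edges f)

  ultrahomogeneous-resp-iso : {H : Digraph b r₁} → DigraphIsomorphism G H →
                              Ultrahomogeneous H → Ultrahomogeneous G
  ultrahomogeneous-resp-iso {H = H} h uh u v f =
    iso-trans h (iso-trans φ (iso-sym h)) ,
    λ i → trans (cong (from h) (φu≡v i)) (from-to h _)
    where
    f′ : DigraphIsomorphism (induced H (↔⇒↣ (bijection h) ↣-∘ u))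
                            (induced H (↔⇒↣ (bijection h) ↣-∘ v))
    f′ = record
      { bijection = bijection f
      ; edges     = λ i j → edges h _ _ ⇔-∘ (edges f i j ⇔-∘ ⇔-sym (edges h _ _))
      }
    extension = uh (↔⇒↣ (bijection h) ↣-∘ u) (↔⇒↣ (bijection h) ↣-∘ v) f′
    φ = proj₁ extension
    φu≡v = proj₂ extension

-- Transpositions and criteria for one-point homogeneity

module Transposition {A : Set a} (_≟ᴬ_ : DecidableEquality A) (x y : A) where

  swap : A → A
  swap z with z ≟ᴬ x | z ≟ᴬ y
  ... | yes _ | _     = y
  ... | no _  | yes _ = x
  ... | no _  | no _  = z

  swap-left : swap x ≡ y
  swap-left with x ≟ᴬ x
  ... | yes _  = refl
  ... | no x≢x = contradiction refl x≢x

  swap-right : swap y ≡ x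
  swap-right with y ≟ᴬ x | y ≟ᴬ y
  ... | yes y≡x | _      = y≡x
  ... | no _    | yes _  = refl
  ... | no _    | no y≢y = contradiction refl y≢y

  swap-fixed : ∀ {z} → z ≢ x → z ≢ y → swap z ≡ z
  swap-fixed {z} z≢x z≢y with z ≟ᴬ x | z ≟ᴬ y
  ... | yes z≡x | _       = contradiction z≡x z≢x
  ... | no _    | yes z≡y = contradiction z≡y z≢y
  ... | no _    | no _    = refl

  swap-involutive : ∀ z → swap (swap z) ≡ z
  swap-involutive z = case-on (z ≟ᴬ x) (z ≟ᴬ y)
    where
    case-on : Dec (z ≡ x) → Dec (z ≡ y) → swap (swap z) ≡ z
    case-on (yes refl) _          = trans (cong swap swap-left) swap-right
    case-on (no _)     (yes refl) = trans (cong swap swap-right) swap-left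
    case-on (no z≢x)   (no z≢y)   = trans (cong swap (swap-fixed z≢x z≢y)) (swap-fixed z≢x z≢y)

  swap-↔ : A ↔ A
  swap-↔ = mk↔ₛ′ swap swap swap-involutive swap-involutive

edgeless-onePoint : {G : Digraph a r} → DecidableEquality (Vertex G) →
                    (∀ x y → ¬ Edge G x y) → OnePointHomogeneous G
edgeless-onePoint {G = G} _≟ⱽ_ noEdge v x y same-type =
  record { bijection = swap-↔
         ; edges = λ _ _ → mk⇔ (⊥-elim ∘ noEdge _ _) (⊥-elim ∘ noEdge _ _) } ,
  swap-left , fixes
  where
  open Transposition _≟ⱽ_ x y
  fixes : ∀ i → swap (v i) ≡ v i
  fixes i = case v i ≟ⱽ x of λ where
      -- Here `v i` equals both `x` and `y`, so the transposition leaves it in place.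
      (yes v≡x) → trans (cong swap v≡x) (trans swap-left (sym (v≡x⇔v≡y.to v≡x)))
      (no v≢x)  → swap-fixed v≢x (v≢x ∘ v≡x⇔v≡y.from)
    where module v≡x⇔v≡y = Equivalence (SameType.equal (same-type i))

VertexTransitive : Digraph a r → Set (a ⊔ r)
VertexTransitive G = ∀ x y → ∃ λ (φ : DigraphAutomorphism G) → to φ x ≡ y

-- One fixed vertex already forces `x ≡ y`, so the identity serves; with no fixed vertex,
-- transitivity suffices.
rigid-onePoint : {G : Digraph a r} → VertexTransitive G →
                 (∀ v x y → SameType G v x y → x ≡ y) → OnePointHomogeneous G
rigid-onePoint transitive rigid {zero}  v x y _  = let φ , φx≡y = transitive x y in
                                                   φ , φx≡y , λ ()
rigid-onePoint transitive rigid {suc n} v x y st = iso-id , rigid (v 0F) x y (st 0F) , λ _ → refl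

module _ {I : Set b} {i₀ : I} {C : PartialMonounaryAlgebra a d} where

  -- An element of the wreath product: `τ i` acts inside copy `i`, then `σ` permutes the copies.
  copies-automorphism : I ↔ I → (I → DigraphAutomorphism (C *)) →
                        DigraphAutomorphism (copies I i₀ C *)
  copies-automorphism σ τ = record
    { bijection = mk↔ₛ′
        (λ (i , x) → σ.to i , to (τ i) x)
        (λ (i , x) → σ.from i , from (τ (σ.from i)) x)
        (λ (i , x) → cong₂ _,_ (σ.strictlyInverseˡ i) (to-from (τ (σ.from i)) x))
        (λ (i , x) → cong₂ _,_ (σ.strictlyInverseʳ i) (untwist (σ.strictlyInverseʳ i) x))
    ; edges = λ (i , x) (j , y) → mk⇔ forth back
    }
    where
    module σ = Inverse σ

    untwist : ∀ {i j} → j ≡ i → ∀ x → from (τ j) (to (τ i) x) ≡ x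
    untwist refl = from-to (τ _)

    forth : ∀ {i j x y} → Edge (copies I i₀ C *) (i , x) (j , y) →
            Edge (copies I i₀ C *) (σ.to i , to (τ i) x) (σ.to j , to (τ j) y)
    forth {i} (p , refl) = let q , e = edge-to (τ i) (p , refl) in q , cong (σ.to i ,_) e

    back : ∀ {i j x y} → Edge (copies I i₀ C *) (σ.to i , to (τ i) x) (σ.to j , to (τ j) y) →
           Edge (copies I i₀ C *) (i , x) (j , y)
    -- Edges stay within one copy, so injectivity of `σ` identifies the two indices.
    back {i} (q , e) with Injection.injective (↔⇒↣ σ) (cong proj₁ e)
    ... | refl = let p , e′ = edge-from (τ i) (q , cong proj₂ e) in p , cong (i ,_) e′

  copies-onePoint : DecidableEquality I → VertexTransitive (C *) →
    (∀ v x y → proj₁ v ≡ proj₁ x → SameType (copies I i₀ C *) v x y → x ≡ y) →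
    OnePointHomogeneous (copies I i₀ C *)
  copies-onePoint _≟ᴵ_ transitive rigid v x@(i , k) y@(j , l) same-type
    with any? (λ m → proj₁ (v m) ≟ᴵ i) | any? (λ m → proj₁ (v m) ≟ᴵ j)
  ... | yes (m , vm∈i) | _ = iso-id , rigid (v m) x y vm∈i (same-type m) , λ _ → refl
  ... | no _ | yes (m , vm∈j) =
    iso-id , sym (rigid (v m) y x vm∈j (SameType-sym (same-type m))) , λ _ → refl
  ... | no v∉i | no v∉j =
    -- No fixed vertex lies in copies `i` and `j`, which are exchanged after an automorphism of `C`
    -- taking `k` to `l` has acted on copy `i`. This also covers `i ≡ j`.
    copies-automorphism swap-↔ (λ h → twist (h ≟ᴵ i)) ,
    cong₂ _,_ swap-left (twist-i (i ≟ᴵ i)) ,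
    λ m → cong₂ _,_ (swap-fixed (v∉i ∘ (m ,_)) (v∉j ∘ (m ,_))) (twist-off (v∉i ∘ (m ,_)) (_ ≟ᴵ i))
    where
    open Transposition _≟ᴵ_ i j

    twist : ∀ {h} → Dec (h ≡ i) → DigraphAutomorphism (C *)
    twist (yes _) = proj₁ (transitive k l)
    twist (no _)  = iso-id

    twist-i : (i≟i : Dec (i ≡ i)) → to (twist i≟i) k ≡ l
    twist-i (yes _)  = proj₂ (transitive k l)
    twist-i (no i≢i) = contradiction refl i≢i

    twist-off : ∀ {h z} → h ≢ i → (h≟i : Dec (h ≡ i)) → to (twist h≟i) z ≡ z
    twist-off h≢i (yes h≡i) = contradiction h≡i h≢i
    twist-off h≢i (no _)    = refl

-- Periodic maps

module Periodic {V : Set a} (s : V → V) (n : ℕ) .{{_ : NonZero n}}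
                (period : ∀ x → fold x s n ≡ x) where

  fold-multiple : ∀ q x → fold x s (q * n) ≡ x
  fold-multiple zero    x = refl
  fold-multiple (suc q) x = begin
    fold x s (n + q * n)        ≡⟨ fold-+ x s n ⟩
    fold (fold x s (q * n)) s n ≡⟨ period _ ⟩
    fold x s (q * n)            ≡⟨ fold-multiple q x ⟩
    x                           ∎
    where open ≡-Reasoning

  fold-mod : ∀ k x → fold x s (toℕ (k mod n)) ≡ fold x s k
  fold-mod k x = sym (begin
    fold x s k                              ≡⟨ cong (fold x s) (m≡m%n+[m/n]*n k n) ⟩
    fold x s (k % n + k / n * n)            ≡⟨ fold-+ x s (k % n) ⟩
    fold (fold x s (k / n * n)) s (k % n)   ≡⟨ cong (λ z → fold z s (k % n)) (fold-multiple (k / n) x) ⟩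
    fold x s (k % n)                        ≡⟨ cong (fold x s) (toℕ-fromℕ< (m%n<n k n)) ⟨
    fold x s (toℕ (k mod n))                ∎)
    where open ≡-Reasoning

  fold-inverse : ∀ k x → ∃ λ l → fold (fold x s k) s l ≡ x
  -- `k * n` steps are `k` full periods, so `k * n ∸ k` steps undo the first `k`.
  fold-inverse k x = k * n ∸ k , (begin
    fold (fold x s k) s (k * n ∸ k) ≡⟨ fold-+ x s (k * n ∸ k) ⟨
    fold x s (k * n ∸ k + k)        ≡⟨ cong (fold x s) (m∸n+n≡m (m≤m*n k n)) ⟩
    fold x s (k * n)                ≡⟨ fold-multiple k x ⟩
    x                               ∎)
    where open ≡-Reasoning

  module Free (free : ∀ x {k} → 0 < k → k < n → fold x s k ≢ x) where

    -- After a coincidence at `j` and `k`, another `n ∸ k` steps would return to `x` after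
    -- `n ∸ k + j` steps in all, a number strictly between `0` and `n`.
    fold-distinct : ∀ x {j k} → j < k → k < n → fold x s j ≢ fold x s k
    fold-distinct x {j} {k} j<k k<n eq =
      free x (≤-trans (m<n⇒0<n∸m k<n) (m≤m+n _ j))
             (subst (n ∸ k + j <_) (m∸n+n≡m (<⇒≤ k<n)) (+-monoʳ-< (n ∸ k) j<k))
             (begin
               fold x s (n ∸ k + j)        ≡⟨ fold-+ x s (n ∸ k) ⟩
               fold (fold x s j) s (n ∸ k) ≡⟨ cong (λ z → fold z s (n ∸ k)) eq ⟩
               fold (fold x s k) s (n ∸ k) ≡⟨ fold-+ x s (n ∸ k) ⟨
               fold x s (n ∸ k + k)        ≡⟨ cong (fold x s) (m∸n+n≡m (<⇒≤ k<n)) ⟩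
               fold x s n                  ≡⟨ period x ⟩
               x                           ∎)
      where open ≡-Reasoning

    fold-injective : ∀ x {j k : Fin n} → fold x s (toℕ j) ≡ fold x s (toℕ k) → j ≡ k
    fold-injective x {j} {k} eq with <-cmp (toℕ j) (toℕ k)
    ... | tri< j<k _ _ = contradiction eq (fold-distinct x j<k (toℕ<n k))
    ... | tri≈ _ j≡k _ = toℕ-injective j≡k
    ... | tri> _ _ k<j = contradiction (sym eq) (fold-distinct x k<j (toℕ<n j))

-- The cycles 𝒵 n

successor : (n : ℕ) .{{_ : NonZero n}} → Fin n → Fin n
successor n i = suc (toℕ i) mod n

module CyclicShift (m : ℕ) where

  private
    n = suc m
    s = successor n

  period? : Dec (∀ x → fold x s n ≡ x)
  period? = all? λ x → fold x s n ≟ x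

  reachable? : Dec (∀ x y → ∃ λ (k : Fin n) → fold x s (toℕ k) ≡ y)
  reachable? = all? λ x → all? λ y → any? λ k → fold x s (toℕ k) ≟ y

  -- True for cycles of length 2 and 3; false for length 4, where opposite vertices are neither
  -- equal nor adjacent.
  adjacent? : Dec (∀ v x → v ≡ x ⊎ s v ≡ x ⊎ s x ≡ v)
  adjacent? = all? λ v → all? λ x → v ≟ x ⊎-dec s v ≟ x ⊎-dec s x ≟ v

  module _ (period : ∀ x → fold x s n ≡ x) where

    shift : DigraphAutomorphism (𝒵 n *)
    shift = record
      { bijection = s-↔
      ; edges     = λ x y → mk⇔
          (λ (_ , e) → _ , cong s e)
          (λ (_ , e) → _ , Injection.injective (↔⇒↣ s-↔) e)
      }
      where
      unshift : ∀ x → fold (s x) s m ≡ x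
      unshift x = begin
        fold (s x) s m   ≡⟨ fold-+ x s m ⟨
        fold x s (m + 1) ≡⟨ cong (fold x s) (+-comm m 1) ⟩
        fold x s n       ≡⟨ period x ⟩
        x                ∎
        where open ≡-Reasoning

      -- As `n` is `suc m`, the inverse of `s` is its `m`-th iterate.
      s-↔ : Fin n ↔ Fin n
      s-↔ = mk↔ₛ′ s (λ x → fold x s m) period unshift

    shifts : ℕ → DigraphAutomorphism (𝒵 n *)
    shifts = fold iso-id (λ φ → iso-trans φ shift)

    to-shifts : ∀ k x → to (shifts k) x ≡ fold x s k
    to-shifts zero    x = refl
    to-shifts (suc k) x = cong s (to-shifts k x)

    𝒵-transitive : (∀ x y → ∃ λ (k : Fin n) → fold x s (toℕ k) ≡ y) → VertexTransitive (𝒵 n *)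
    𝒵-transitive reach x y =
      let k , e = reach x y in shifts (toℕ k) , trans (to-shifts (toℕ k) x) e

    -- A fixed vertex on the cycle of `x` is `x`, its predecessor or its successor; `y` bears the
    -- same relation to it, and each relation determines a unique vertex.
    copies-𝒵-onePoint : {I : Set b} (i₀ : I) → DecidableEquality I → VertexTransitive (𝒵 n *) →
      (∀ v x → v ≡ x ⊎ s v ≡ x ⊎ s x ≡ v) → OnePointHomogeneous (copies I i₀ (𝒵 n) *)
    copies-𝒵-onePoint {I = I} i₀ _≟ᴵ_ transitive adjacent =
      copies-onePoint {i₀ = i₀} {C = 𝒵 n} _≟ᴵ_ transitive rigid
      where
      rigid : ∀ v x y → proj₁ v ≡ proj₁ x → SameType (copies I i₀ (𝒵 n) *) v x y → x ≡ y
      rigid (i , k) (_ , l) (j , m) refl t with adjacent k l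
      ... | inj₁ refl        = Equivalence.to (SameType.equal t) refl
      ... | inj₂ (inj₁ refl) = proj₂ (Equivalence.to (SameType.edge-in t) (_ , refl))
      ... | inj₂ (inj₂ refl) =
        let _ , e = Equivalence.to (SameType.edge-out t) (_ , refl) in
        cong₂ _,_ (sym (cong proj₁ e)) (sym (to-injective shift (cong proj₂ e)))

module _ {I : Set b} (i₀ : I) (_≟ᴵ_ : DecidableEquality I) where

  copies-𝒵₂-onePoint : OnePointHomogeneous (copies I i₀ (𝒵 2) *)
  copies-𝒵₂-onePoint = copies-𝒵-onePoint (from-yes period?) i₀ _≟ᴵ_
    (𝒵-transitive (from-yes period?) (from-yes reachable?)) (from-yes adjacent?)
    where open CyclicShift 1

  copies-𝒵₃-onePoint : OnePointHomogeneous (copies I i₀ (𝒵 3) *)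
  copies-𝒵₃-onePoint = copies-𝒵-onePoint (from-yes period?) i₀ _≟ᴵ_
    (𝒵-transitive (from-yes period?) (from-yes reachable?)) (from-yes adjacent?)
    where open CyclicShift 2

-- Over a vertex `v` of the 4-cycle, each of the four types is realized once: by `v`, its successor,
-- its predecessor and the opposite vertex. `decided` checks all triples.
𝒵₄-onePoint : OnePointHomogeneous (𝒵 4 *)
𝒵₄-onePoint = rigid-onePoint
  (𝒵-transitive (from-yes period?) (from-yes reachable?))
  (λ v x y t → decided v x y
    (Equivalence.to (SameType.equal t)) (Equivalence.from (SameType.equal t))
    (λ e → proj₂ (Equivalence.to (SameType.edge-in t) (_ , e)))
    (λ e → proj₂ (Equivalence.from (SameType.edge-in t) (_ , e)))
    (λ e → proj₂ (Equivalence.to (SameType.edge-out t) (_ , e)))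
    (λ e → proj₂ (Equivalence.from (SameType.edge-out t) (_ , e))))
  where
  open CyclicShift 3
  s = successor 4
  decided : ∀ v x y → (v ≡ x → v ≡ y) → (v ≡ y → v ≡ x) →
            (s v ≡ x → s v ≡ y) → (s v ≡ y → s v ≡ x) →
            (s x ≡ v → s y ≡ v) → (s y ≡ v → s x ≡ v) → x ≡ y
  decided = from-yes (all? λ v → all? λ x → all? λ y →
    (v ≟ x →-dec v ≟ y) →-dec (v ≟ y →-dec v ≟ x) →-dec
    (s v ≟ x →-dec s v ≟ y) →-dec (s v ≟ y →-dec s v ≟ x) →-dec
    (s x ≟ v →-dec s y ≟ v) →-dec (s y ≟ v →-dec s x ≟ v) →-dec x ≟ y)

-- Algebras all of whose cycles have the same length

↔-fromInjective : {A : Set a} {B : Set b} (f : A → B) (g : B → A) →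
                  (∀ {x y} → f x ≡ f y → x ≡ y) → (∀ y → f (g y) ≡ y) → A ↔ B
↔-fromInjective f g injective section = mk↔ₛ′ f g section (λ x → injective (section (f x)))

-- `h` runs from `B` to `A` because in the applications it is the iteration map out of the standard
-- cycles.
total-≅ : (A : PartialMonounaryAlgebra a d) (B : PartialMonounaryAlgebra b e)
          (h : Carrier B ↔ Carrier A) → (∀ x → dom A x) → (∀ y → dom B y) →
          (∀ y p q → Inverse.to h (θ B y q) ≡ θ A (Inverse.to h y) p) → A ≅ B
total-≅ A B h totalA totalB commutes = record
  { bijection = ↔-sym h
  ; domain    = λ x → mk⇔ (λ _ → totalB _) (λ _ → totalA _)
  ; commutes  = λ x p q → Injection.injective (↔⇒↣ h) (begin
      h.to (h.from (θ A x p))           ≡⟨ h.strictlyInverseˡ _ ⟩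
      θ A x p                           ≡⟨ θ-cong (sym (h.strictlyInverseˡ x)) ⟩
      θ A (h.to (h.from x)) (totalA _)  ≡⟨ commutes (h.from x) (totalA _) q ⟨
      h.to (θ B (h.from x) q)           ∎)
  }
  where
  module h = Inverse h
  open ≡-Reasoning
  θ-cong : ∀ {x x′ p p′} → x ≡ x′ → θ A x p ≡ θ A x′ p′
  θ-cong refl = θ-irrelevant A _ _

-- Excluded middle chooses from each inhabited type, and functional extensionality
-- makes the Boolean characteristic functions of equivalent elements equal, so that
-- the same choice is made throughout a class.
representatives : {V : Set a} → ExcludedMiddle a → Extensionality a 0ℓ →
  {_~_ : Rel V a} → IsEquivalence _~_ →
  ∃ λ (rep : V → V) → (∀ x → rep x ~ x) × (∀ {x y} → x ~ y → rep x ≡ rep y)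
representatives {V = V} em ext {_~_} ~-equivalence = rep , rep-~ , rep-cong
  where
  module ~ = IsEquivalence ~-equivalence

  class : V → V → Bool
  class x y = isYes (em {y ~ x})

  class-cong : ∀ {x y} → x ~ y → class x ≡ class y
  class-cong x~y = ext λ z →
    trans (isYes≗does em)
      (trans (does-⇔ (mk⇔ (λ z~x → ~.trans z~x x~y) (λ z~y → ~.trans z~y (~.sym x~y))) em em)
             (sym (isYes≗does em)))

  -- The inhabitation proof is irrelevant, so the element picked depends on `c` alone.
  pick : (c : V → Bool) → .(∃ λ y → T (c y)) → ∃ λ y → T (c y)
  pick c = recompute em

  self : ∀ x → ∃ λ y → T (class x y)
  self x = x , fromWitness {a? = em} ~.refl

  rep : V → V
  rep x = proj₁ (pick (class x) (self x))

  rep-~ : ∀ x → rep x ~ x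
  rep-~ x = toWitness {a? = em} (proj₂ (pick (class x) (self x)))

  pick-cong : ∀ {c c′} .(p : ∃ λ y → T (c y)) .(p′ : ∃ λ y → T (c′ y)) → c ≡ c′ →
              proj₁ (pick c p) ≡ proj₁ (pick c′ p′)
  pick-cong _ _ refl = refl

  rep-cong : ∀ {x y} → x ~ y → rep x ≡ rep y
  rep-cong x~y = pick-cong (self _) (self _) (class-cong x~y)

module Cycles (A : PartialMonounaryAlgebra a d) (total : ∀ x → dom A x)
              (n : ℕ) .{{_ : NonZero n}} where

  private
    V = Carrier A
    s : V → V
    s x = θ A x (total x)

  module _ (period : ∀ x → fold x s n ≡ x)
           (free : ∀ x {k} → 0 < k → k < n → fold x s k ≢ x) where

    open Periodic s n period
    open Free free

    ≅𝒵 : (x₀ : V) → (∀ x → ∃ λ k → fold x₀ s k ≡ x) → A ≅ 𝒵 n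
    ≅𝒵 x₀ generates = total-≅ A (𝒵 n)
      (↔-fromInjective (λ k → fold x₀ s (toℕ k)) (λ x → proj₁ (generates x) mod n)
        (fold-injective x₀)
        (λ x → trans (fold-mod _ x₀) (proj₂ (generates x))))
      total _
      -- The wrap-around of the successor in `𝒵 n` is absorbed by periodicity.
      (λ k _ _ → trans (fold-mod (suc (toℕ k)) x₀) (θ-irrelevant A _ _))

    -- The orbits of `s` index the copies; each is parametrized by iterating `s` from a chosen base
    -- point.
    ≅copies-𝒵 : ExcludedMiddle a → Extensionality a 0ℓ → V →
                Σ (Set a) λ I → Σ I λ i₀ → A ≅ copies I i₀ (𝒵 n)
    ≅copies-𝒵 em ext x₀ = I , class x₀ , total-≅ A (copies I (class x₀) (𝒵 n))
      (↔-fromInjective decode encode decode-injective decode-encode)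
      total _
      (λ ((r , _) , k) _ _ → trans (fold-mod (suc (toℕ k)) r) (θ-irrelevant A _ _))
      where
      -- Forward reachability is symmetric because `s` is periodic.
      _~_ : Rel V a
      x ~ y = ∃ λ k → fold x s k ≡ y

      ~-equivalence : IsEquivalence _~_
      ~-equivalence = record
        { refl  = 0 , refl
        ; sym   = λ { {x} (k , refl) → fold-inverse k x }
        ; trans = λ { {x} (k , refl) (l , e) → l + k , trans (fold-+ x s l) e }
        }

      reps = representatives em ext ~-equivalence
      rep = proj₁ reps
      rep-~ = proj₁ (proj₂ reps)
      rep-cong = proj₂ (proj₂ reps)

      -- The vertices fixed by `rep`, exactly one in each orbit.
      I : Set a
      I = Σ V λ r → rep r ≡ r

      class : V → I
      class x = rep x , rep-cong (rep-~ x)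

      decode : I × Fin n → V
      decode ((r , _) , k) = fold r s (toℕ k)

      encode : V → I × Fin n
      encode x = class x , proj₁ (rep-~ x) mod n

      decode-encode : ∀ x → decode (encode x) ≡ x
      decode-encode x = trans (fold-mod (proj₁ (rep-~ x)) (rep x)) (proj₂ (rep-~ x))

      -- Equal values put both base points in one orbit, so these agree; freeness then identifies
      -- the exponents, and uniqueness of identity proofs the membership proofs in `I`.
      decode-injective : ∀ {p q} → decode p ≡ decode q → p ≡ q
      decode-injective {(r , rep-r) , k} {(r′ , rep-r′) , l} eq with r≡r′
        where
        r≡r′ : r ≡ r′
        r≡r′ = begin
          r                       ≡⟨ rep-r ⟨
          rep r                   ≡⟨ rep-cong (toℕ k , refl) ⟩
          rep (fold r s (toℕ k))  ≡⟨ cong rep eq ⟩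
          rep (fold r′ s (toℕ l)) ≡⟨ rep-cong (toℕ l , refl) ⟨
          rep r′                  ≡⟨ rep-r′ ⟩
          r′                      ∎
          where open ≡-Reasoning
      ... | refl = cong₂ (λ e m → (r , e) , m) (≡-irrelevant rep-r rep-r′) (fold-injective r eq)

-- The partial algebra of a directed pseudoforest

module _ (M : DirectedPseudoforest a r) where

  open DirectedPseudoforest M renaming (digraph to G)

  -- A proof that `x` is in the domain carries the target of its edge, so `θ` is a projection, and
  -- outdegree at most one makes it independent of the proof.
  functionGraph : PartialMonounaryAlgebra a (a ⊔ r)
  functionGraph = record
    { Carrier      = Vertex G
    ; point        = point
    ; dom          = λ x → ∃ (Edge G x)
    ; θ            = λ _ → proj₁
    ; θ-irrelevant = λ (_ , e) (_ , e′) → outdegree≤1 e e′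
    }

  ≐functionGraph : G ≐ functionGraph *
  ≐functionGraph = same λ x y → mk⇔ (λ e → (y , e) , refl) λ { ((_ , e) , refl) → e }

-- Consequences of ultrahomogeneity

module UltrahomogeneousPseudoforest
         (M : DirectedPseudoforest a r)
         (uh : Ultrahomogeneous (DirectedPseudoforest.digraph M)) where

  open DirectedPseudoforest M renaming (digraph to G)

  private
    V = Vertex G

  -- Without loops, any two one-vertex induced subdigraphs are isomorphic.
  transitive : VertexTransitive G
  transitive x y = let φ , φu≡v = uh (constant x) (constant y) f in φ , φu≡v 0F
    where
    constant : V → Fin 1 ↣ V
    constant z = mk↣ {to = λ _ → z} λ { {0F} {0F} _ → refl }

    f : DigraphIsomorphism (induced G (constant x)) (induced G (constant y))
    f = record
      { bijection = ↔-id _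
      ; edges     = λ _ _ → mk⇔ (⊥-elim ∘ loopless refl) (⊥-elim ∘ loopless refl)
      }

  record Nonadjacent (x x′ : V) : Set (a ⊔ r) where
    constructor nonadjacent
    field
      distinct : x ≢ x′
      no-edge  : ¬ Edge G x x′
      no-edge′ : ¬ Edge G x′ x

  -- Both pairs induce edgeless subdigraphs on two vertices, so matching them in order is an
  -- isomorphism.
  transitive-nonadjacent : ∀ {x x′ y y′} → Nonadjacent x x′ → Nonadjacent y y′ →
                           ∃ λ (φ : DigraphAutomorphism G) → to φ x ≡ y × to φ x′ ≡ y′
  transitive-nonadjacent {x} {x′} {y} {y′} p q =
    let φ , φu≡v = uh (pair p) (pair q) f in φ , φu≡v 0F , φu≡v 1F
    where
    pair : ∀ {z z′} → Nonadjacent z z′ → Fin 2 ↣ V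
    pair {z} {z′} n = mk↣ {to = λ { 0F → z ; 1F → z′ }}
      λ { {0F} {0F} _ → refl
        ; {0F} {1F} e → contradiction e (Nonadjacent.distinct n)
        ; {1F} {0F} e → contradiction (sym e) (Nonadjacent.distinct n)
        ; {1F} {1F} _ → refl
        }

    edgeless : ∀ {z z′} (n : Nonadjacent z z′) i j → ¬ Edge (induced G (pair n)) i j
    edgeless n 0F 0F = loopless refl
    edgeless n 0F 1F = Nonadjacent.no-edge n
    edgeless n 1F 0F = Nonadjacent.no-edge′ n
    edgeless n 1F 1F = loopless refl

    f : DigraphIsomorphism (induced G (pair p)) (induced G (pair q))
    f = record
      { bijection = ↔-id _
      ; edges     = λ i j → mk⇔ (⊥-elim ∘ edgeless p i j) (⊥-elim ∘ edgeless q i j)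
      }

  outedge-everywhere : ∀ {x} → ∃ (Edge G x) → ∀ y → ∃ (Edge G y)
  outedge-everywhere {x} (z , e) y =
    let φ , φx≡y = transitive x y in
    to φ z , subst (λ w → Edge G w (to φ z)) φx≡y (edge-to φ e)

  module Total (total : ∀ x → ∃ (Edge G x)) where

    s : V → V
    s x = proj₁ (total x)

    edge-s : ∀ x → Edge G x (s x)
    edge-s x = proj₂ (total x)

    s-unique : ∀ {x y} → Edge G x y → s x ≡ y
    s-unique = outdegree≤1 (edge-s _)

    s-irreflexive : ∀ x → s x ≢ x
    s-irreflexive x sx≡x = loopless (sym sx≡x) (edge-s x)

    -- Automorphisms commute with `s`, since `s x` is the only out-neighbour of `x`.
    automorphism-fold : ∀ (φ : DigraphAutomorphism G) x k → to φ (fold x s k) ≡ fold (to φ x) s k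
    automorphism-fold φ x zero    = refl
    automorphism-fold φ x (suc k) =
      trans (sym (s-unique (edge-to φ (edge-s _)))) (cong s (automorphism-fold φ x k))

    fold-fixed-everywhere : ∀ k {x} → fold x s k ≡ x → ∀ y → fold y s k ≡ y
    fold-fixed-everywhere k {x} fixed y = let φ , φx≡y = transitive x y in
      subst (λ z → fold z s k ≡ z) φx≡y (trans (sym (automorphism-fold φ x k)) (cong (to φ) fixed))

    module NoShortCycles (s²≢ : ∀ x → fold x s 2 ≢ x) (s³≢ : ∀ x → fold x s 3 ≢ x) where

      -- An edge from `x` to `s² x` would make `s x` a fixed point of `s`; an edge back would close
      -- a 3-cycle.
      nonadjacent-s² : ∀ x → Nonadjacent x (fold x s 2)
      nonadjacent-s² x = nonadjacent (s²≢ x ∘ sym)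
        (s-irreflexive (s x) ∘ sym ∘ s-unique) (s³≢ x ∘ s-unique)

      -- The exchange of x and s² x extends to an automorphism.
      s⁴ : ∀ x → fold x s 4 ≡ x
      s⁴ x = let φ , φx≡s²x , φs²x≡x =
                   transitive-nonadjacent (nonadjacent-s² x) (nonadjacent′ (nonadjacent-s² x)) in
             trans (cong (λ z → fold z s 2) (sym φx≡s²x)) (trans (sym (automorphism-fold φ x 2)) φs²x≡x)
        where
        nonadjacent′ : ∀ {x y} → Nonadjacent x y → Nonadjacent y x
        nonadjacent′ (nonadjacent d e e′) = nonadjacent (d ∘ sym) e′ e

      -- An automorphism fixing x also fixes s² x, so it cannot move s² x to y.
      nonadjacent⇒s² : ∀ {x y} → Nonadjacent x y → fold x s 2 ≡ y
      nonadjacent⇒s² {x} xy =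
        let φ , φx≡x , φs²x≡y = transitive-nonadjacent (nonadjacent-s² x) xy in
        trans (sym (trans (automorphism-fold φ x 2) (cong (λ z → fold z s 2) φx≡x))) φs²x≡y

      generates : ExcludedMiddle a → ExcludedMiddle r → ∀ x y → ∃ λ k → fold x s k ≡ y
      generates em-a em-r x y with em-a {x ≡ y} | em-r {Edge G x y} | em-r {Edge G y x}
      ... | yes x≡y | _     | _      = 0 , x≡y
      ... | no _    | yes e | _      = 1 , s-unique e
      -- `y` precedes `x` on a 4-cycle, hence is three steps ahead of it.
      ... | no _    | no _  | yes e  = 3 , (begin
        fold x s 3     ≡⟨ cong (λ z → fold z s 3) (s-unique e) ⟨
        fold (s y) s 3 ≡⟨ s⁴ y ⟩
        y              ∎)
        where open ≡-Reasoning
      ... | no x≢y  | no ¬e | no ¬e′ = 2 , nonadjacent⇒s² (nonadjacent x≢y ¬e ¬e′)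

-- Assembling the two directions of the classification

theorem4p17 : ∀ {a r} → ExcludedMiddle (a ⊔ r) → Extensionality a a →
    (M : DirectedPseudoforest a r) →
    Ultrahomogeneous (DirectedPseudoforest.digraph M) ⇔
    (∃ λ (A : PartialMonounaryAlgebra a (a ⊔ r)) →
    DirectedPseudoforest.digraph M ≐ A * ×
    ( (Σ (Set a) λ I → Σ I λ i₀ → A ≅ copies I i₀ (𝒵 2))
    ⊎ (Σ (Set a) λ I → Σ I λ i₀ → A ≅ copies I i₀ (𝒵 3))
    ⊎ (A ≅ 𝒵 4)
    ⊎ (∃ λ (B : PartialMonounaryAlgebra a (a ⊔ r)) →
    Empty (PartialMonounaryAlgebra.dom B) × A ≅ B)))
theorem4p17 {a} {r} em ext M = mk⇔ classify ultrahomogeneous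
  where
  open DirectedPseudoforest M renaming (digraph to G)

  em-a : ExcludedMiddle a
  em-a {P} = map′ lower lift (em {Lift r P})

  em-r : ExcludedMiddle r
  em-r {P} = map′ lower lift (em {Lift a P})

  ext₀ : Extensionality a 0ℓ
  ext₀ = lower-extensionality 0ℓ a ext

  A = functionGraph M

  Classified : PartialMonounaryAlgebra a (a ⊔ r) → Set _
  Classified A =
      (Σ (Set a) λ I → Σ I λ i₀ → A ≅ copies I i₀ (𝒵 2))
    ⊎ (Σ (Set a) λ I → Σ I λ i₀ → A ≅ copies I i₀ (𝒵 3))
    ⊎ (A ≅ 𝒵 4)
    ⊎ (∃ λ (B : PartialMonounaryAlgebra a (a ⊔ r)) → Empty (dom B) × A ≅ B)

  classify : Ultrahomogeneous G → ∃ λ A → G ≐ A * × Classified A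
  classify uh = A , ≐functionGraph M , by-domain em
    where
    open UltrahomogeneousPseudoforest M uh

    module _ (total : ∀ x → ∃ (Edge G x)) where
      open Total total

      by-period : Dec (fold point s 2 ≡ point) → Dec (fold point s 3 ≡ point) → Classified A
      by-period (yes s²) _ = inj₁
        (Cycles.≅copies-𝒵 A total 2 (fold-fixed-everywhere 2 s²) free em-a ext₀ point)
        where
        free : ∀ x {k} → 0 < k → k < 2 → fold x s k ≢ x
        free x {1} _ _ = s-irreflexive x
        free x {suc (suc _)} _ (s<s (s<s ()))
      by-period (no s²≢) (yes s³) = inj₂ (inj₁
        (Cycles.≅copies-𝒵 A total 3 (fold-fixed-everywhere 3 s³) free em-a ext₀ point))
        where
        free : ∀ x {k} → 0 < k → k < 3 → fold x s k ≢ x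
        free x {1} _ _ = s-irreflexive x
        -- A return after two steps at one vertex would occur at `point` as well.
        free x {2} _ _ = λ e → s²≢ (fold-fixed-everywhere 2 e point)
        free x {suc (suc (suc _))} _ (s<s (s<s (s<s ())))
      by-period (no s²≢) (no s³≢) = inj₂ (inj₂ (inj₁
        (Cycles.≅𝒵 A total 4 s⁴ free point (generates em-a em-r point))))
        where
        open NoShortCycles (λ x e → s²≢ (fold-fixed-everywhere 2 e point))
                           (λ x e → s³≢ (fold-fixed-everywhere 3 e point))
        free : ∀ x {k} → 0 < k → k < 4 → fold x s k ≢ x
        free x {1} _ _ = s-irreflexive x
        free x {2} _ _ = λ e → s²≢ (fold-fixed-everywhere 2 e point)
        free x {3} _ _ = λ e → s³≢ (fold-fixed-everywhere 3 e point)
        free x {suc (suc (suc (suc _)))} _ (s<s (s<s (s<s (s<s ()))))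

    by-domain : Dec (∃ (Edge G point)) → Classified A
    by-domain (yes e) = by-period (outedge-everywhere e) em-a em-a
    -- An outgoing edge anywhere would give one at `point`, so the domain of `A` is empty and `A`
    -- itself serves as `B`.
    by-domain (no ¬e) = inj₂ (inj₂ (inj₂ (A , (λ _ e → ¬e (outedge-everywhere e point)) , A≅A)))
      where
      A≅A : A ≅ A
      A≅A = record
        { bijection = ↔-id _
        ; domain    = λ _ → ⇔-id _
        ; commutes  = λ _ → θ-irrelevant A
        }

  ultrahomogeneous : (∃ λ A → G ≐ A * × Classified A) → Ultrahomogeneous G
  ultrahomogeneous (A , G≐A* , classified) =
    ultrahomogeneous-resp-iso (≐⇒iso G≐A*) (uh-A classified)
    where
    via : ∀ {b e} {B : PartialMonounaryAlgebra b e} → A ≅ B → OnePointHomogeneous (B *) →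
          Ultrahomogeneous (A *)
    via A≅B one = ultrahomogeneous-resp-iso (≅⇒iso A≅B) (onePoint⇒ultrahomogeneous one)

    uh-A : Classified A → Ultrahomogeneous (A *)
    uh-A (inj₁ (_ , i₀ , A≅))              = via A≅ (copies-𝒵₂-onePoint i₀ λ _ _ → em-a)
    uh-A (inj₂ (inj₁ (_ , i₀ , A≅)))       = via A≅ (copies-𝒵₃-onePoint i₀ λ _ _ → em-a)
    uh-A (inj₂ (inj₂ (inj₁ A≅)))           = via A≅ 𝒵₄-onePoint
    uh-A (inj₂ (inj₂ (inj₂ (_ , ∅ , A≅)))) =
      via A≅ (edgeless-onePoint (λ _ _ → em-a) λ x _ (p , _) → ∅ x p)
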